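{- Define the following six words of length $18$ over the alphabet $\{0,1,2\}$ (written as strings of letters): $$U_0=210201202120102012,\qquad V_0=210201021202102012,$$ $$U_1=021012010201210120,\qquad V_1=021012102010210120,$$ $$U_2=102120121012021201,\qquad V_2=102120210121021201.$$ Then $[[U_0,V_0],[U_1,V_1],[U_2,V_2]]$ is an $18$-Brinkhuis triple-pair.
   Context: A word is a finite sequence of letters; it is square-free if it cannot be written as a concatenation $a\,x\,x\,b$ with $a,b$ (possibly empty) words and $x$ a non-empty word. Let $k$ be a positive integer. A triple-pair $[[U_0,V_0],[U_1,V_1],[U_2,V_2]]$, where $U_0,V_0,U_1,V_1,U_2,V_2$ are words over the alphabet $\{0,1,2\}$ all of the same length $k$, is called a $k$-Brinkhuis triple-pair if the following two conditions hold: (1) For all $i,j\in\{0,1,2\}$ with $i\ne j$, all $X\in\{U_i,V_i\}$ and all $Y\in\{U_j,V_j\}$, the concatenation $XY$ (a word of length $2k$) is square-free. (These are $24$ words: $U_0U_1, U_0V_1,\dots,V_2V_1$.) (2) For every integer $r$ with $k/2\le r<k$, the $12$ words consisting of the heads (prefixes) of length $r$ and the tails (suffixes) of length $r$ of the six words $U_0,U_1,U_2,V_0,V_1,V_2$ are all distinct (that is, the six prefixes and six suffixes are pairwise distinct as words). -}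

module Defs where

open import Data.Fin using (Fin)
open import Data.Fin.Patterns using (0F; 1F; 2F)
open import Data.List using (List; []; _∷_; _++_; length; map; take; drop)
open import Data.List.Membership.Propositional using (_∈_)
open import Data.List.Relation.Unary.Unique.Propositional using (Unique)
open import Data.Nat using (ℕ; _*_; _∸_; _≤_; _<_)
open import Data.Product using (_×_; _,_; proj₁; proj₂; ∃-syntax)
open import Data.Vec as Vec using (Vec; []; _∷_; lookup)
open import Relation.Binary.PropositionalEquality using (_≡_; _≢_)
open import Relation.Nullary using (¬_)

Letter : Set
Letter = Fin 3

Word : Set
Word = List Letter

SquareFree : Word → Set
SquareFree w = ¬ (∃[ a ] ∃[ x ] ∃[ b ] (x ≢ [] × w ≡ a ++ x ++ x ++ b))

TriplePair : Set
TriplePair = Vec (Word × Word) 3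

pairAt : TriplePair → Fin 3 → List Word
pairAt T i = proj₁ (lookup T i) ∷ proj₂ (lookup T i) ∷ []

sixWords : TriplePair → List Word
sixWords T = Vec.toList (Vec.map proj₁ T) ++ Vec.toList (Vec.map proj₂ T)

-- Prefix and suffix of length r; only meaningful when r ≤ length w.
head tail : ℕ → Word → Word
head r w = take r w
tail r w = drop (length w ∸ r) w

record IsBrinkhuis (k : ℕ) (T : TriplePair) : Set where
  field
    k-positive    : 0 < k
    words-length  : ∀ {w} → w ∈ sixWords T → length w ≡ k
    square-free   : ∀ {i j} → i ≢ j →
                    ∀ {X Y} → X ∈ pairAt T i → Y ∈ pairAt T j →
                    SquareFree (X ++ Y)
    -- k ≤ 2 * r expresses k/2 ≤ r without rounding when k is odd.
    ends-distinct : ∀ r → k ≤ 2 * r → r < k →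
                    Unique (map (head r) (sixWords T) ++ map (tail r) (sixWords T))

U₀ U₁ U₂ : Word
U₀ = 2F ∷ 1F ∷ 0F ∷ 2F ∷ 0F ∷ 1F ∷ 2F ∷ 0F ∷ 2F ∷ 1F ∷ 2F ∷ 0F ∷ 1F ∷ 0F ∷ 2F ∷ 0F ∷ 1F ∷ 2F ∷ []
U₁ = 0F ∷ 2F ∷ 1F ∷ 0F ∷ 1F ∷ 2F ∷ 0F ∷ 1F ∷ 0F ∷ 2F ∷ 0F ∷ 1F ∷ 2F ∷ 1F ∷ 0F ∷ 1F ∷ 2F ∷ 0F ∷ []
U₂ = 1F ∷ 0F ∷ 2F ∷ 1F ∷ 2F ∷ 0F ∷ 1F ∷ 2F ∷ 1F ∷ 0F ∷ 1F ∷ 2F ∷ 0F ∷ 2F ∷ 1F ∷ 2F ∷ 0F ∷ 1F ∷ []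

V₀ V₁ V₂ : Word
V₀ = 2F ∷ 1F ∷ 0F ∷ 2F ∷ 0F ∷ 1F ∷ 0F ∷ 2F ∷ 1F ∷ 2F ∷ 0F ∷ 2F ∷ 1F ∷ 0F ∷ 2F ∷ 0F ∷ 1F ∷ 2F ∷ []
V₁ = 0F ∷ 2F ∷ 1F ∷ 0F ∷ 1F ∷ 2F ∷ 1F ∷ 0F ∷ 2F ∷ 0F ∷ 1F ∷ 0F ∷ 2F ∷ 1F ∷ 0F ∷ 1F ∷ 2F ∷ 0F ∷ []
V₂ = 1F ∷ 0F ∷ 2F ∷ 1F ∷ 2F ∷ 0F ∷ 2F ∷ 1F ∷ 0F ∷ 1F ∷ 2F ∷ 1F ∷ 0F ∷ 2F ∷ 1F ∷ 2F ∷ 0F ∷ 1F ∷ []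

{-# OPTIONS --safe #-}
module Submission where

open import Defs
open import Data.Fin.Properties as Fin using (_≟_)
open import Data.List using (List; []; _∷_; _++_; length; map; take; drop)
open import Data.List.Properties using (≡-dec; length-++; length-++-≤ˡ; length-++-≤ʳ)
open import Data.List.Relation.Unary.All as All using (All)
open import Data.List.Relation.Unary.Unique.DecPropositional (≡-dec (_≟_ {3})) using (Unique; unique?)
open import Data.Nat using (ℕ; _*_; _≤_; _<_; suc; s≤s; z≤n; _≤?_)
open import Data.Nat.Properties as ℕ using (allUpTo?)
open import Data.Product using (_,_)
open import Data.Vec using ([]; _∷_)
open import Relation.Binary.PropositionalEquality using (_≡_; _≢_; refl; sym; cong; subst)
open import Relation.Nullary using (¬?; from-yes; _→-dec_)
open import Relation.Unary using (Decidable)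

-- Every condition is a finite check once square-freeness is made finite. A square `x ++ x` in `w`
-- is determined by its starting position and by the length of `x`, both bounded by `length w`, so
-- comparing adjacent blocks of equal length at each position decides the matter.
-- `noSquareFactor⇒squareFree` transfers the bounded check to arbitrary factorisations; evaluating
-- decision procedures does the rest.

take-length-++ : ∀ {A : Set} (xs ys : List A) → take (length xs) (xs ++ ys) ≡ xs
take-length-++ []       ys = refl
take-length-++ (x ∷ xs) ys = cong (x ∷_) (take-length-++ xs ys)

drop-length-++ : ∀ {A : Set} (xs ys : List A) → drop (length xs) (xs ++ ys) ≡ ys
drop-length-++ []       ys = refl
drop-length-++ (x ∷ xs) ys = drop-length-++ xs ys

-- For v ≢ [] with 2(m + 1) > length v the two factors have different lengths, so the
-- inequality holds automatically and no bound relating m to length v is needed.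
NoSquarePrefix : Word → ℕ → Set
NoSquarePrefix v m = take (suc m) v ≢ take (suc m) (drop (suc m) v)

NoSquareFactor : Word → Set
NoSquareFactor w = ∀ {i} → i < length w → ∀ {m} → m < length w → NoSquarePrefix (drop i w) m

noSquareFactor? : Decidable NoSquareFactor
noSquareFactor? w =
  allUpTo? (λ i → allUpTo? (λ m → ¬? (≡-dec _≟_ _ _)) (length w)) (length w)

square-prefix : ∀ (x b : Word) →
                take (length x) (x ++ x ++ b) ≡ take (length x) (drop (length x) (x ++ x ++ b))
square-prefix x b
  rewrite drop-length-++ x (x ++ b) | take-length-++ x (x ++ b) | take-length-++ x b = refl

-- A factorisation `a ++ x ++ x ++ b` is caught at position `length a` with block length `length x`.
noSquareFactor⇒squareFree : ∀ {w} → NoSquareFactor w → SquareFree w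
noSquareFactor⇒squareFree noSq (a , []          , b , x≢[] , _)    = x≢[] refl
noSquareFactor⇒squareFree noSq (a , x@(c ∷ x′) , b , _    , refl) =
  subst (λ v → NoSquarePrefix v (length x′)) (drop-length-++ a xxb) (noSq a<w x≤w)
    (square-prefix x b)
  where
  xxb : Word
  xxb = x ++ x ++ b

  a<w : length a < length (a ++ xxb)
  a<w = subst (length a <_) (sym (length-++ a)) (ℕ.m<m+n (length a) (s≤s z≤n))

  -- With `m = length x′`, the required `m < length w` unfolds to exactly this.
  x≤w : length x ≤ length (a ++ xxb)
  x≤w = ℕ.≤-trans (length-++-≤ˡ x) (length-++-≤ʳ xxb {a})

mainTheorem2 : IsBrinkhuis 18 ((U₀ , V₀) ∷ (U₁ , V₁) ∷ (U₂ , V₂) ∷ [])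
mainTheorem2 = record
  { k-positive    = s≤s z≤n
  ; words-length  = All.lookup (from-yes (All.all? (λ w → length w ℕ.≟ 18) (sixWords T)))
  ; square-free   = λ {i} {j} i≢j X∈ Y∈ →
      noSquareFactor⇒squareFree (All.lookup (All.lookup (noSquares i j i≢j) X∈) Y∈)
  ; ends-distinct = λ _ 18≤2r r<18 → ends-unique r<18 18≤2r
  }
  where
  T : TriplePair
  T = (U₀ , V₀) ∷ (U₁ , V₁) ∷ (U₂ , V₂) ∷ []

  -- Having `i ≢ j` as a decidable premise makes this one decision over all index pairs; the
  -- diagonal ones hold vacuously.
  noSquares : ∀ i j → i ≢ j →
              All (λ X → All (λ Y → NoSquareFactor (X ++ Y)) (pairAt T j)) (pairAt T i)
  noSquares = from-yes (Fin.all? λ i → Fin.all? λ j → ¬? (i ≟ j) →-dec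
    All.all? (λ X → All.all? (λ Y → noSquareFactor? (X ++ Y)) (pairAt T j)) (pairAt T i))

  ends : ℕ → List Word
  ends r = map (head r) (sixWords T) ++ map (tail r) (sixWords T)

  -- The upper bound comes first because it delimits the search of `allUpTo?`; the lower bound is a
  -- decidable premise, leaving `r` from 9 to 17 to test.
  ends-unique : ∀ {r} → r < 18 → 18 ≤ 2 * r → Unique (ends r)
  ends-unique = from-yes (allUpTo? (λ r → (18 ≤? 2 * r) →-dec unique? (ends r)) 18)
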